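{- Let $G$ and $H$ be block graphs, neither of which has a simplicial vertex of degree at least $2$. If $G$ and $H$ are locally equivalent, then $G$ and $H$ are isomorphic.
   Context: Graphs are finite and simple. A block of a graph is a maximal connected subgraph without cut-vertices. A graph is a block graph if every block of it is a complete graph. A vertex is simplicial if its set of neighbors is a clique. The local complementation at a vertex $v$ of $G$ replaces the induced subgraph of $G$ on the neighborhood of $v$ by its complement. Two graphs are locally equivalent if one can be obtained from the other by a sequence of local complementations. -}

module Defs where

open import Data.Nat using (ℕ; _≤_)
open import Data.Bool using (Bool; true; false; _∧_; not; if_then_else_; T)
open import Data.Fin using (Fin; _≟_)
open import Data.Fin.Permutation using (Permutation′; _⟨$⟩ʳ_)
open import Data.List using (List; length; filter; allFin)
open import Data.Product using (Σ; _×_; ∃; ∃-syntax)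
open import Relation.Nullary using (¬_; ⌊_⌋)
open import Relation.Nullary.Decidable using (T?)
open import Relation.Binary.PropositionalEquality using (_≡_; _≢_)
open import Relation.Binary.Construct.Closure.ReflexiveTransitive using (Star)

Graph : ℕ → Set
Graph n = Fin n → Fin n → Bool

IsSimple : ∀ {n} → Graph n → Set
IsSimple {n} G = (∀ (x y : Fin n) → G x y ≡ G y x) × (∀ (x : Fin n) → G x x ≡ false)

degree : ∀ {n} → Graph n → Fin n → ℕ
degree {n} G v = length (filter (λ u → T? (G v u)) (allFin n))

Simplicial : ∀ {n} → Graph n → Fin n → Set
Simplicial {n} G v = ∀ (u w : Fin n) → T (G v u) → T (G v w) → u ≢ w → T (G u w)

record Subgraph {n : ℕ} (G : Graph n) : Set where
  field
    V : Fin n → Bool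
    E : Fin n → Fin n → Bool
    E⊆G    : ∀ x y → T (E x y) → T (G x y)
    E-ends : ∀ x y → T (E x y) → T (V x) × T (V y)
    E-sym  : ∀ x y → E x y ≡ E y x
open Subgraph public

_⊑_ : ∀ {n} {G : Graph n} → Subgraph G → Subgraph G → Set
_⊑_ {n} K K' = (∀ (x : Fin n) → T (V K x) → T (V K' x))
             × (∀ (x y : Fin n) → T (E K x y) → T (E K' x y))

data Walk {n : ℕ} (E : Fin n → Fin n → Bool) (P : Fin n → Set) : Fin n → Fin n → Set where
  here : ∀ {u} → P u → Walk E P u u
  step : ∀ {u x w} → P u → T (E u x) → Walk E P x w → Walk E P u w

Connected : ∀ {n} {G : Graph n} → Subgraph G → Set
Connected {n} K =
  (∃[ u ] T (V K u)) ×
  (∀ (u w : Fin n) → T (V K u) → T (V K w) → Walk (E K) (λ x → T (V K x)) u w)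

-- Cut-vertex of a connected subgraph K: a vertex v of K whose deletion
-- disconnects K (i.e. increases the number of components).
CutVertex : ∀ {n} {G : Graph n} → Subgraph G → Fin n → Set
CutVertex {n} K v =
  T (V K v) ×
  Σ (Fin n) λ u → Σ (Fin n) λ w →
    T (V K u) × T (V K w) × u ≢ v × w ≢ v ×
    ¬ Walk (E K) (λ x → T (V K x) × x ≢ v) u w

Biconn : ∀ {n} {G : Graph n} → Subgraph G → Set
Biconn {n} K = Connected K × (∀ (v : Fin n) → ¬ CutVertex K v)

Block : ∀ {n} (G : Graph n) → Subgraph G → Set
Block G K = Biconn K × (∀ (K' : Subgraph G) → K ⊑ K' → Biconn K' → K' ⊑ K)

Complete : ∀ {n} {G : Graph n} → Subgraph G → Set
Complete {n} K = ∀ (u w : Fin n) → T (V K u) → T (V K w) → u ≢ w → T (E K u w)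

IsBlockGraph : ∀ {n} → Graph n → Set
IsBlockGraph G = ∀ K → Block G K → Complete K

localComp : ∀ {n} → Graph n → Fin n → Graph n
localComp G v x y =
  if G v x ∧ G v y ∧ not ⌊ x ≟ y ⌋ then not (G x y) else G x y

LCStep : ∀ {n} → Graph n → Graph n → Set
LCStep {n} G H = ∃[ v ] (∀ (x y : Fin n) → H x y ≡ localComp G v x y)

LocallyEquivalent : ∀ {n} → Graph n → Graph n → Set
LocallyEquivalent = Star LCStep

Isomorphic : ∀ {n} → Graph n → Graph n → Set
Isomorphic {n} G H =
  Σ (Permutation′ n) λ π → ∀ (x y : Fin n) → G x y ≡ H (π ⟨$⟩ʳ x) (π ⟨$⟩ʳ y)

NoSimplicialDeg≥2 : ∀ {n} → Graph n → Set
NoSimplicialDeg≥2 {n} G = ∀ (v : Fin n) → Simplicial G v → ¬ (2 ≤ degree G v)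

{-# OPTIONS --safe #-}
module Submission where

-- Having rank at most 1, or rank 0, across a vertex set S is invariant under
-- local complementation at v, which adds multiples of row (or column) v to the
-- matrix of the cut. In a block graph two nonadjacent vertices u, v of one
-- component are separated by a cut vertex w; if S is the component of u after
-- deleting w, both S and S ∪ {w} have cuts of rank at most 1. If these cuts have
-- rank at most 1 also in a second block graph where u and v are adjacent, then
-- there w is either simplicial or has degree at most 1. Hence two of the graphs
-- with the same cuts and the same vertices of degree at most 1 coincide. A vertex
-- of degree at most 1 in G only is pendant to some b in G while b is pendant to it
-- in H; exchanging the two labels in H is a pivot, so it preserves the cuts.

open import Defs
open import Data.Nat using (ℕ; zero; suc; _+_; _≤_; _<_; z≤n; s≤s)
open import Data.Nat.Properties using (m≤n+m; ≤-trans; +-identityʳ; +-suc; +-monoˡ-≤; <-irrefl)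
open import Data.Bool using (Bool; true; false; T; _∧_; _xor_)
open import Data.Bool.Properties using (xor-assoc; xor-comm; xor-same; xor-identityʳ; ∧-comm; ∧-identityʳ; ∧-zeroʳ; T-≡; T-∧)
open import Data.Empty using (⊥; ⊥-elim)
open import Data.Fin using (Fin; zero; suc; _≟_)
open import Data.Fin.Permutation using (Permutation′; _⟨$⟩ʳ_; _⟨$⟩ˡ_; _∘ₚ_; transpose; inverseˡ; inverseʳ) renaming (id to idₚ)
open import Data.Fin.Properties using (any?; all?; ¬∀⟶∃¬)
open import Data.Fin.Subset using (∣_∣)
open import Data.Fin.Subset.Properties using (p⊂q⇒∣p∣<∣q∣; ∣p∣≤n)
open import Data.List using (List; []; _∷_; length; allFin)
open import Data.List.Membership.Propositional using (_∈_)
open import Data.List.Membership.Propositional.Properties using (∈-filter⁺; ∈-allFin)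
open import Data.List.Relation.Unary.Any using (here; there)
open import Data.Product using (Σ; _×_; _,_; ∃-syntax; proj₁; proj₂)
open import Data.Sum using (_⊎_; inj₁; inj₂)
open import Data.Unit using (⊤; tt)
open import Data.Vec using (tabulate)
open import Data.Vec.Properties using (lookup∘tabulate; lookup⇒[]=; []=⇒lookup)
open import Function using (_∘_; id; Equivalence)
open import Relation.Binary.Construct.Closure.ReflexiveTransitive using (ε; _◅_)
open import Relation.Binary.PropositionalEquality using (_≡_; _≢_; refl; sym; trans; cong; cong₂; subst; subst₂; ≢-sym; module ≡-Reasoning)
open import Relation.Nullary using (¬_; Dec; yes; no; ⌊_⌋; contradiction)
open import Relation.Nullary.Decidable using (T?; toWitness; fromWitness; decidable-stable; ¬?; _×-dec_; _→-dec_; _⊎-dec_; ¬¬-excluded-middle; dec-true; dec-false)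

private
  variable
    n : ℕ

-- Walks and paths

module _ {E : Fin n → Fin n → Bool} {P : Fin n → Set} where

  start : ∀ {u v} → Walk E P u v → P u
  start (here p)     = p
  start (step p _ _) = p

  _⌢_ : ∀ {u v w} → Walk E P u v → Walk E P v w → Walk E P u w
  here _     ⌢ q = q
  step p e r ⌢ q = step p e (r ⌢ q)

  end : ∀ {u v} → Walk E P u v → P v
  end (here p)     = p
  end (step _ _ r) = end r

  snoc : ∀ {u v w} → Walk E P u v → T (E v w) → P w → Walk E P u w
  snoc r e p = r ⌢ step (end r) e (here p)

  reverse : (∀ {x y} → T (E x y) → T (E y x)) →
            ∀ {u v} → Walk E P u v → Walk E P v u
  reverse s (here p)     = here p
  reverse s (step p e r) = snoc (reverse s r) (s e) p

  exit : (S : Fin n → Bool) → ∀ {u v} → Walk E P u v → T (S u) → ¬ T (S v) →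
         ∃[ a ] ∃[ b ] T (S a) × ¬ T (S b) × T (E a b)
  exit S (here _) Su ¬Sv = contradiction Su ¬Sv
  exit S (step {x = x} _ e r) Su ¬Sv with T? (S x)
  ... | yes Sx = exit S r Sx ¬Sv
  ... | no ¬Sx = _ , _ , Su , ¬Sx , e

mapWalk : ∀ {E E′ : Fin n → Fin n → Bool} {P Q : Fin n → Set} (φ : Fin n → Fin n) →
          (∀ {x y} → P x → P y → T (E x y) → T (E′ (φ x) (φ y))) →
          (∀ {x} → P x → Q (φ x)) →
          ∀ {u v} → Walk E P u v → Walk E′ Q (φ u) (φ v)
mapWalk φ f g (here p)     = here (g p)
mapWalk φ f g (step p e r) = step (g p) (f p (start r) e) (mapWalk φ f g r)

weaken : ∀ {E : Fin n → Fin n → Bool} {P Q : Fin n → Set} → (∀ {x} → P x → Q x) →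
         ∀ {u v} → Walk E P u v → Walk E Q u v
weaken = mapWalk id λ _ _ e → e

-- Vertices do not repeat: each `cons` stores that its head is new, which makes the definition
-- inductive-recursive.
data Path {n} (G : Graph n) : Fin n → Fin n → Set
_∈ᵖ_ : ∀ {n} {G : Graph n} {x y} → Fin n → Path G x y → Set

data Path {n} G where
  [_]  : ∀ x → Path G x x
  cons : ∀ u {x y} → T (G u x) → (p : Path G x y) → ¬ (u ∈ᵖ p) → Path G u y

z ∈ᵖ [ x ]        = z ≡ x
z ∈ᵖ cons u _ p _ = z ≡ u ⊎ z ∈ᵖ p

module _ {G : Graph n} where

  _∈ᵖ?_ : ∀ {x y} z (p : Path G x y) → Dec (z ∈ᵖ p)
  z ∈ᵖ? [ x ]        = z ≟ x
  z ∈ᵖ? cons u _ p _ = (z ≟ u) ⊎-dec (z ∈ᵖ? p)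

  start∈ : ∀ {x y} (p : Path G x y) → x ∈ᵖ p
  start∈ [ x ]          = refl
  start∈ (cons u _ _ _) = inj₁ refl

  end∈ : ∀ {x y} (p : Path G x y) → y ∈ᵖ p
  end∈ [ x ]          = refl
  end∈ (cons u _ p _) = inj₂ (end∈ p)

  suffix : ∀ {x y z} (p : Path G x y) → z ∈ᵖ p →
           Σ (Path G z y) λ q → ∀ {t} → t ∈ᵖ q → t ∈ᵖ p
  suffix [ x ] refl = [ x ] , id
  suffix (cons u e p u∉p) (inj₁ refl) = cons u e p u∉p , id
  suffix (cons u e p u∉p) (inj₂ z∈p) with suffix p z∈p
  ... | q , q⊆p = q , inj₂ ∘ q⊆p

  walk⇒path : ∀ {P : Fin n → Set} {x y} → Walk G P x y →
              Σ (Path G x y) λ p → ∀ {t} → t ∈ᵖ p → P t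
  walk⇒path (here p) = [ _ ] , λ { refl → p }
  walk⇒path (step {u = u} Pu e r) with walk⇒path r
  ... | p , p⊆P with u ∈ᵖ? p
  ...   | no u∉p = cons u e p u∉p , λ { (inj₁ refl) → Pu ; (inj₂ t∈p) → p⊆P t∈p }
  -- The walk returns to `u`; the loop is cut off.
  ...   | yes u∈p with suffix p u∈p
  ...     | q , q⊆p = q , p⊆P ∘ q⊆p

  path⇒walk : ∀ {x y} (p : Path G x y) → Walk G (_∈ᵖ p) x y
  path⇒walk [ x ] = here refl
  path⇒walk (cons u e p _) = step (inj₁ refl) e (weaken inj₂ (path⇒walk p))

  walkToEnd : ∀ {x y z} (p : Path G x y) → z ∈ᵖ p → Walk G (_∈ᵖ p) z y
  walkToEnd p z∈p with suffix p z∈p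
  ... | q , q⊆p = weaken q⊆p (path⇒walk q)

  -- Deleting `v` leaves at most two pieces of the path, each containing an end. If `v` is the head,
  -- the rest of the path avoids it because vertices do not repeat.
  walkToAnEnd : (∀ {x y} → T (G x y) → T (G y x)) →
                ∀ {x y z} (p : Path G x y) v → z ∈ᵖ p → z ≢ v →
                Walk G (λ t → t ∈ᵖ p × t ≢ v) z x ⊎ Walk G (λ t → t ∈ᵖ p × t ≢ v) z y
  walkToAnEnd s [ x ] v refl z≢v = inj₁ (here (refl , z≢v))
  walkToAnEnd s (cons u e p u∉p) v (inj₁ refl) z≢v = inj₁ (here (inj₁ refl , z≢v))
  walkToAnEnd s (cons u e p u∉p) v (inj₂ z∈p) z≢v with walkToAnEnd s p v z∈p z≢v
  ... | inj₂ r = inj₂ (weaken (λ (i , j) → inj₂ i , j) r)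
  ... | inj₁ r with u ≟ v
  ...   | no u≢v = inj₁ (snoc (weaken (λ (i , j) → inj₂ i , j) r) (s e) (inj₁ refl , u≢v))
  ...   | yes refl = inj₂ (weaken (λ i → inj₂ i , λ { refl → u∉p i }) (walkToEnd p z∈p))

-- Block graphs without simplicial vertices of degree at least 2

induced : (G : Graph n) → IsSimple G → (Fin n → Bool) → Subgraph G
induced G (G-sym , _) S = record
  { V      = S
  ; E      = λ x y → G x y ∧ (S x ∧ S y)
  ; E⊆G    = λ x y → proj₁ ∘ Equivalence.to T-∧
  ; E-ends = λ x y → Equivalence.to T-∧ ∘ proj₂ ∘ Equivalence.to (T-∧ {G x y})
  ; E-sym  = λ x y → cong₂ _∧_ (G-sym x y) (∧-comm (S x) (S y))
  }

module _ {G : Graph n} (simple : IsSimple G) where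

  private
    G-sym = proj₁ simple

  induced-edge : ∀ {S} {x y} → T (S x) → T (S y) → T (G x y) → T (E (induced G simple S) x y)
  induced-edge Sx Sy e = Equivalence.from T-∧ (e , Equivalence.from T-∧ (Sx , Sy))

  -- Adding edges on the same vertices keeps all walks.
  induced-biconn : (K : Subgraph G) → Biconn K → Biconn (induced G simple (V K))
  induced-biconn K (((x , Vx) , conn) , _) .proj₁ =
    (x , Vx) , λ u w Vu Vw → mapWalk id (λ {x} {y} Vx Vy e → induced-edge {V K} Vx Vy (E⊆G K x y e)) id (conn u w Vu Vw)
  induced-biconn K (_ , nocut) .proj₂ v (Vv , u , w , Vu , Vw , u≢v , w≢v , ¬walk) =
    nocut v (Vv , u , w , Vu , Vw , u≢v , w≢v , λ r → ¬walk
      (mapWalk id (λ {x} {y} Vx Vy e → induced-edge {V K} (proj₁ Vx) (proj₁ Vy) (E⊆G K x y e)) id r))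

  ∣V∣ : Subgraph G → ℕ
  ∣V∣ K = ∣ tabulate (V K) ∣

  ∣V∣-mono-< : ∀ (K K′ : Subgraph G) → (∀ x → T (V K x) → T (V K′ x)) →
               ∀ {x} → T (V K′ x) → ¬ T (V K x) → ∣V∣ K < ∣V∣ K′
  ∣V∣-mono-< K K′ K⊆K′ {x} x∈K′ x∉K =
    p⊂q⇒∣p∣<∣q∣ ((λ {x} → insert (V K′) ∘ K⊆K′ x ∘ extract (V K)) , x , insert (V K′) x∈K′ , x∉K ∘ extract (V K))
    where
    insert : ∀ (f : Fin n → Bool) {x} → T (f x) → x Data.Fin.Subset.∈ tabulate f
    insert f {x} t = lookup⇒[]= x _ (trans (lookup∘tabulate f x) (Equivalence.to T-≡ t))
    extract : ∀ (f : Fin n → Bool) {x} → x Data.Fin.Subset.∈ tabulate f → T (f x)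
    extract f {x} m = Equivalence.from T-≡ (trans (sym (lookup∘tabulate f x)) ([]=⇒lookup m))

  -- The induced subgraph on V K is a block unless some biconnected subgraph
  -- has more vertices, so a missing edge is pushed up the finitely many sizes.
  biconn⇒adjacent : IsBlockGraph G → ∀ K → Biconn K →
                    ∀ {x y} → T (V K x) → T (V K y) → x ≢ y → T (G x y)
  biconn⇒adjacent block K bK {x} {y} Kx Ky x≢y =
    decidable-stable (T? (G x y)) λ ¬xy → refute ¬xy n K bK (m≤n+m n (∣V∣ K)) Kx Ky
    where
    refute : ¬ T (G x y) → ∀ k K → Biconn K → n ≤ ∣V∣ K + k → T (V K x) → T (V K y) → ⊥
    refute ¬xy k K bK n≤ Kx Ky =
      ¬xy (proj₁ (Equivalence.to T-∧ (block I (bI , maximal) x y Kx Ky x≢y)))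
      where
      -- Maximality concerns edges too; with all edges of `G` on these vertices present, only a
      -- larger vertex set can extend `I`.
      I  = induced G simple (V K)
      bI = induced-biconn K bK
      bigger : ∀ k K′ → n ≤ ∣V∣ K + k → ∣V∣ K < ∣V∣ K′ → Biconn K′ → T (V K′ x) → T (V K′ y) → ⊥
      -- Here `K` already has `n` vertices, so `K′` would have more than `n`.
      bigger zero K′ n≤ K<K′ bK′ _ _ = <-irrefl refl (≤-trans (s≤s (subst (n ≤_) (+-identityʳ _) n≤)) (≤-trans K<K′ (∣p∣≤n (tabulate (V K′)))))
      bigger (suc k) K′ n≤ K<K′ bK′ x∈ y∈ =
        refute ¬xy k K′ bK′ (≤-trans (subst (n ≤_) (+-suc _ k) n≤) (+-monoˡ-≤ k K<K′)) x∈ y∈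
      maximal : ∀ K′ → I ⊑ K′ → Biconn K′ → K′ ⊑ I
      maximal K′ (I⊆K′ , _) bK′ with all? (λ z → T? (V K′ z) →-dec T? (V K z))
      ... | yes K′⊆I = K′⊆I , λ a b e → let (a∈ , b∈) = E-ends K′ a b e in
            induced-edge {V K} (K′⊆I a a∈) (K′⊆I b b∈) (E⊆G K′ a b e)
      ... | no ¬K′⊆I with ¬∀⟶∃¬ n _ (λ z → T? (V K′ z) →-dec T? (V K z)) ¬K′⊆I
      ...   | z , ¬z = ⊥-elim (bigger k K′ n≤
                (∣V∣-mono-< K K′ I⊆K′ {z} (decidable-stable (T? (V K′ z)) λ ∉K′ → ¬z (⊥-elim ∘ ∉K′)) (λ t → ¬z λ _ → t))
                bK′ (I⊆K′ x Kx) (I⊆K′ y Ky))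

  private
    flip : ∀ {x y} → T (G x y) → T (G y x)
    flip {x} {y} = subst T (G-sym x y)

  onCycle : ∀ w {x y} → Path G x y → Subgraph G
  onCycle w p = induced G simple (λ z → ⌊ (z ≟ w) ⊎-dec (z ∈ᵖ? p) ⌋)

  -- Deleting `w` leaves the path connected. After deleting another vertex, every remaining vertex
  -- still reaches an end of the path, and from there `w`.
  cycle-biconn : ∀ {w x y} → T (G w x) → T (G w y) → (p : Path G x y) → (∀ {t} → t ∈ᵖ p → t ≢ w) →
                 Biconn (onCycle w p)
  cycle-biconn {w} {x} {y} wx wy p p∌w = ((w , fromWitness (inj₁ refl)) , connected) , noCut
    where
    On : Fin n → Set
    On z = z ≡ w ⊎ z ∈ᵖ p
    K = onCycle w p
    toK : ∀ {Q R : Fin n → Set} → (∀ {t} → Q t → On t) → (∀ {t} → Q t → R t) →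
          ∀ {u v} → Walk G Q u v → Walk (E K) R u v
    toK Q⊆On = mapWalk id λ Qa Qb → induced-edge {V K} (fromWitness (Q⊆On Qa)) (fromWitness (Q⊆On Qb))
    toHub : ∀ {z} → On z → Walk G On z w
    toHub (inj₁ refl) = here (inj₁ refl)
    toHub (inj₂ z∈p)  = snoc (weaken inj₂ (walkToEnd p z∈p)) (flip wy) (inj₁ refl)
    toHubAvoiding : ∀ {v z} → w ≢ v → On z → z ≢ v → Walk G (λ t → On t × t ≢ v) z w
    toHubAvoiding w≢v (inj₁ refl) z≢v = here (inj₁ refl , z≢v)
    toHubAvoiding {v} w≢v (inj₂ z∈p) z≢v with walkToAnEnd flip p v z∈p z≢v
    ... | inj₁ r = snoc (weaken (λ (i , j) → inj₂ i , j) r) (flip wx) (inj₁ refl , w≢v)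
    ... | inj₂ r = snoc (weaken (λ (i , j) → inj₂ i , j) r) (flip wy) (inj₁ refl , w≢v)
    connected : ∀ u v → T (V K u) → T (V K v) → Walk (E K) (λ z → T (V K z)) u v
    connected u v Ku Kv = toK id fromWitness (toHub (toWitness Ku) ⌢ reverse flip (toHub (toWitness Kv)))
    onPath : ∀ {z} → On z → z ≢ w → z ∈ᵖ p
    onPath (inj₁ z≡w) z≢w = contradiction z≡w z≢w
    onPath (inj₂ z∈p) _   = z∈p
    noCut : ∀ v → ¬ CutVertex K v
    noCut v (_ , a , b , Ka , Kb , a≢v , b≢v , ¬walk) with w ≟ v
    ... | yes refl = ¬walk (toK inj₂ (λ i → fromWitness (inj₂ i) , p∌w i)
          (walkToEnd p (onPath (toWitness Ka) a≢v) ⌢ reverse flip (walkToEnd p (onPath (toWitness Kb) b≢v))))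
    ... | no w≢v = ¬walk (toK proj₁ (λ (i , j) → fromWitness i , j)
          (toHubAvoiding w≢v (toWitness Ka) a≢v ⌢ reverse flip (toHubAvoiding w≢v (toWitness Kb) b≢v)))

  -- The walk shortens to a path, which `w` closes to a cycle; a cycle lies within one block.
  cycle⇒adjacent : IsBlockGraph G → ∀ {w x y} → T (G w x) → T (G w y) → x ≢ y →
                   Walk G (_≢ w) x y → T (G x y)
  cycle⇒adjacent block {w} wx wy x≢y r with walk⇒path r
  ... | p , p∌w = biconn⇒adjacent block (onCycle w p) (cycle-biconn wx wy p p∌w)
                    (fromWitness (inj₂ (start∈ p))) (fromWitness (inj₂ (end∈ p))) x≢y

HasTwoNeighbours : Graph n → Fin n → Set
HasTwoNeighbours G v = ∃[ x ] ∃[ y ] T (G v x) × T (G v y) × x ≢ y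

hasTwoNeighbours? : (G : Graph n) → ∀ v → Dec (HasTwoNeighbours G v)
hasTwoNeighbours? G v = any? λ x → any? λ y → T? (G v x) ×-dec T? (G v y) ×-dec ¬? (x ≟ y)

2≤length : ∀ {A : Set} {x y : A} {xs} → x ∈ xs → y ∈ xs → x ≢ y → 2 ≤ length xs
2≤length (here refl) (here refl) x≢y = contradiction refl x≢y
2≤length {xs = _ ∷ _ ∷ _} _ _ _ = s≤s (s≤s z≤n)

2≤degree : ∀ {G : Graph n} {v} → HasTwoNeighbours G v → 2 ≤ degree G v
2≤degree {G = G} {v} (x , y , vx , vy , x≢y) =
  2≤length (∈-filter⁺ (λ u → T? (G v u)) (∈-allFin x) vx) (∈-filter⁺ (λ u → T? (G v u)) (∈-allFin y) vy) x≢y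

-- The consequences of the hypotheses on a graph in a form that is easily
-- transported along relabellings of the vertices.
record Admissible (G : Graph n) : Set where
  field
    simple        : IsSimple G
    cycle         : ∀ {w x y} → T (G w x) → T (G w y) → x ≢ y → Walk G (_≢ w) x y → T (G x y)
    nonSimplicial : ∀ {v} → HasTwoNeighbours G v → ¬ Simplicial G v

  ~sym : ∀ {x y} → T (G x y) → T (G y x)
  ~sym {x} {y} = subst T (proj₁ simple x y)

  ~irrefl : ∀ {x y} → T (G x y) → x ≢ y
  ~irrefl xx refl = subst T (proj₂ simple _) xx

  -- The walk `a`, `y`, `b` avoids the common neighbour `x`.
  square : ∀ {a b x y} → a ≢ b → x ≢ y → T (G a x) → T (G b x) → T (G a y) → T (G b y) → T (G a b)
  square a≢b x≢y ax bx ay by = cycle (~sym ax) (~sym bx) a≢b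
    (step (~irrefl ax) ay (step (≢-sym x≢y) (~sym by) (here (~irrefl bx))))

  -- Two neighbours of `w` other than `u` have both `w` and `u` as common neighbours, so `square`
  -- joins them.
  dominated⇒simplicial : ∀ {w u} → T (G w u) → (∀ {r} → T (G w r) → r ≢ u → T (G r u)) → Simplicial G w
  dominated⇒simplicial {w} {u} wu dom p q wp wq p≢q with p ≟ u | q ≟ u
  ... | yes refl | _        = ~sym (dom wq (≢-sym p≢q))
  ... | no p≢u   | yes refl = dom wp p≢u
  ... | no p≢u   | no q≢u   = square p≢q (~irrefl wu) (~sym wp) (~sym wq) (dom wp p≢u) (dom wq q≢u)

  -- On a path u, x, z, … a walk from u to v avoiding x closes a cycle through
  -- z, x, u; the resulting chord uz shortens the path.
  unseparated⇒adjacent : ∀ {u x v} → T (G u x) → (p : Path G x v) → ¬ (u ∈ᵖ p) →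
                         (∀ w → w ≢ u → w ≢ v → ¬ ¬ Walk G (_≢ w) u v) → T (G u v)
  unseparated⇒adjacent ux [ _ ] _ _ = ux
  unseparated⇒adjacent {u} {x} {v} ux (cons x {z} xz p x∉p) u∉ unsep =
    unseparated⇒adjacent uz p (u∉ ∘ inj₂) unsep
    where
    uz : T (G u z)
    uz = decidable-stable (T? (G u z)) λ ¬uz →
      unsep x (≢-sym (~irrefl ux)) (λ { refl → x∉p (end∈ p) }) λ r →
      ¬uz (cycle (~sym ux) xz (λ { refl → u∉ (inj₂ (start∈ p)) })
        (r ⌢ reverse ~sym (weaken (λ { i refl → x∉p i }) (path⇒walk p))))

admissible : {G : Graph n} → IsSimple G → IsBlockGraph G → NoSimplicialDeg≥2 G → Admissible G
admissible {G = G} simple block noSimp = record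
  { simple        = simple
  ; cycle         = cycle⇒adjacent simple block
  ; nonSimplicial = λ two simp → noSimp _ simp (2≤degree {G = G} two)
  }

relabel : Graph n → Permutation′ n → Graph n
relabel G π x y = G (π ⟨$⟩ʳ x) (π ⟨$⟩ʳ y)

permutation-injective : (π : Permutation′ n) → ∀ {x y} → π ⟨$⟩ʳ x ≡ π ⟨$⟩ʳ y → x ≡ y
permutation-injective π eq = trans (sym (inverseˡ π)) (trans (cong (π ⟨$⟩ˡ_) eq) (inverseˡ π))

relabel-admissible : {G : Graph n} → Admissible G → ∀ π → Admissible (relabel G π)
relabel-admissible {n} {G} adm π = record
  { simple        = (λ _ _ → proj₁ simple _ _) , λ _ → proj₂ simple _
  ; cycle         = λ wx wy x≢y r → cycle wx wy (x≢y ∘ injective)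
                      (mapWalk (π ⟨$⟩ʳ_) (λ _ _ e → e) (λ x≢w → x≢w ∘ injective) r)
  ; nonSimplicial = λ (x , y , vx , vy , x≢y) simp →
      nonSimplicial (_ , _ , vx , vy , x≢y ∘ injective) λ a b va vb a≢b →
        subst₂ (λ a b → T (G a b)) (inverseʳ π) (inverseʳ π)
          (simp _ _ (subst (T ∘ G _) (sym (inverseʳ π)) va) (subst (T ∘ G _) (sym (inverseʳ π)) vb)
            λ eq → a≢b (trans (sym (inverseʳ π)) (trans (cong (π ⟨$⟩ʳ_) eq) (inverseʳ π))))
  }
  where
  open Admissible adm
  injective = permutation-injective π

-- Cuts of rank at most 1

Separation : Graph n → (Fin n → Bool) → Set
Separation G S = ∀ {x y} → T (S x) → ¬ T (S y) → ¬ T (G x y)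

-- The matrix of G between S and its complement has rank at most 1 over GF(2).
Split : Graph n → (Fin n → Bool) → Set
Split {n} G S = Σ (Fin n → Bool) λ f → Σ (Fin n → Bool) λ g →
  ∀ {x y} → T (S x) → ¬ T (S y) → G x y ≡ f x ∧ g y

-- The ones of a matrix of rank at most 1 over GF(2) fill a rectangle of rows and columns.
exchange : ∀ {G : Graph n} {S} → Split G S → ∀ {x x′ y y′} → T (S x) → T (S x′) → ¬ T (S y) → ¬ T (S y′) →
           T (G x y) → T (G x′ y′) → T (G x y′)
exchange (f , g , eq) {x} {x′} {y} {y′} Sx Sx′ ¬Sy ¬Sy′ xy x′y′ = subst T (sym (eq Sx ¬Sy′))
  (Equivalence.from (T-∧ {f x} {g y′})
    ( proj₁ (Equivalence.to (T-∧ {f x} {g y}) (subst T (eq Sx ¬Sy) xy))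
    , proj₂ (Equivalence.to (T-∧ {f x′} {g y′}) (subst T (eq Sx′ ¬Sy′) x′y′))))

-- Invariance of cuts under local complementation

record _≼_ (G H : Graph n) : Set where
  field
    split      : ∀ {S} → Split G S → Split H S
    separation : ∀ {S} → Separation G S → Separation H S
open _≼_

≼-refl : {G : Graph n} → G ≼ G
≼-refl = record { split = id ; separation = id }

≼-trans : {F G H : Graph n} → F ≼ G → G ≼ H → F ≼ H
≼-trans p q = record { split = split q ∘ split p ; separation = separation q ∘ separation p }

-- H is the local complement of G at v, up to the diagonal.
LC : Fin n → Graph n → Graph n → Set
LC v G H = ∀ {x y} → x ≢ y → H x y ≡ G x y xor (G v x ∧ G v y)

xor-cancel : ∀ a b → (a xor b) xor b ≡ a
xor-cancel a b = trans (xor-assoc a b b) (trans (cong (a xor_) (xor-same b)) (xor-identityʳ a))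

LC-row : ∀ {v} {G H : Graph n} → IsSimple G → IsSimple H → LC v G H → ∀ x → H v x ≡ G v x
LC-row {v = v} {G} {H} (_ , G-irr) (_ , H-irr) lc x with v ≟ x
... | yes refl = trans (H-irr v) (sym (G-irr v))
... | no v≢x   = trans (lc v≢x) (trans (cong (λ b → G v x xor (b ∧ G v x)) (G-irr v)) (xor-identityʳ (G v x)))

-- Row `v` is unchanged, so complementing again toggles the same pairs back.
LC-sym : ∀ {v} {G H : Graph n} → IsSimple G → IsSimple H → LC v G H → LC v H G
LC-sym {v = v} {G} {H} simpG simpH lc {x} {y} x≢y = sym (trans
  (cong₂ _xor_ (lc x≢y) (cong₂ _∧_ (LC-row simpG simpH lc x) (LC-row simpG simpH lc y)))
  (xor-cancel (G x y) _))

separated⇒≢ : ∀ {S : Fin n → Bool} {x y} → T (S x) → ¬ T (S y) → x ≢ y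
separated⇒≢ Sx ¬Sy refl = ¬Sy Sx

¬T⇒≡false : ∀ {b} → ¬ T b → b ≡ false
¬T⇒≡false {false} _  = refl
¬T⇒≡false {true}  ¬t = contradiction tt ¬t

-- For cuts whose edges all start at `w`: only row `w` is nonzero, and this product is the
-- factorization that `Split` asks for.
starRow : ∀ (G : Graph n) {w x y} (d : Dec (x ≡ w)) → (T (G x y) → x ≡ w) → G x y ≡ ⌊ d ⌋ ∧ G w y
starRow G (yes refl) _    = refl
starRow G (no x≢w)   only = ¬T⇒≡false (x≢w ∘ only)

starColumn : ∀ (G : Graph n) {w x y} (d : Dec (y ≡ w)) → (T (G x y) → y ≡ w) → G x y ≡ G x w ∧ ⌊ d ⌋
starColumn G {w} {x} (yes refl) _    = sym (∧-identityʳ (G x w))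
starColumn G {w} {x} (no y≢w)   only = trans (¬T⇒≡false (y≢w ∘ only)) (sym (∧-zeroʳ (G x w)))

LC⇒≼ : ∀ {v} {G H : Graph n} → IsSimple G → LC v G H → G ≼ H
LC⇒≼ {v = v} {G} {H} (G-sym , _) lc = record { split = splitLC ; separation = separationLC }
  where
  open ≡-Reasoning
  rowOp : ∀ a b c d → (a ∧ b) xor (c ∧ (d ∧ b)) ≡ (a xor (c ∧ d)) ∧ b
  rowOp false _     false _     = refl
  rowOp false _     true  _     = refl
  rowOp true  false false _     = refl
  rowOp true  true  false _     = refl
  rowOp true  false true  false = refl
  rowOp true  false true  true  = refl
  rowOp true  true  true  false = refl
  rowOp true  true  true  true  = refl
  columnOp : ∀ a b c d → (a ∧ b) xor ((a ∧ c) ∧ d) ≡ a ∧ (b xor (c ∧ d))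
  columnOp false _ _ _ = refl
  columnOp true  _ _ _ = refl
  splitLC : ∀ {S} → Split G S → Split H S
  splitLC {S} (f , g , eq) with T? (S v)
  -- Row `v` is added to the rows of its neighbours, which alters only the row factor `f`; for `v`
  -- outside `S`, columns take this role.
  ... | yes Sv = (λ x → f x xor (G v x ∧ f v)) , g , λ {x} {y} Sx ¬Sy → begin
    H x y                                     ≡⟨ lc (separated⇒≢ {S = S} Sx ¬Sy) ⟩
    G x y xor (G v x ∧ G v y)                 ≡⟨ cong₂ (λ a b → a xor (G v x ∧ b)) (eq Sx ¬Sy) (eq Sv ¬Sy) ⟩
    (f x ∧ g y) xor (G v x ∧ (f v ∧ g y))     ≡⟨ rowOp (f x) (g y) (G v x) (f v) ⟩
    (f x xor (G v x ∧ f v)) ∧ g y             ∎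
  ... | no ¬Sv = f , (λ y → g y xor (g v ∧ G v y)) , λ {x} {y} Sx ¬Sy → begin
    H x y                                     ≡⟨ lc (separated⇒≢ {S = S} Sx ¬Sy) ⟩
    G x y xor (G v x ∧ G v y)                 ≡⟨ cong₂ (λ a b → a xor (b ∧ G v y)) (eq Sx ¬Sy) (trans (G-sym v x) (eq Sx ¬Sv)) ⟩
    (f x ∧ g y) xor ((f x ∧ g v) ∧ G v y)     ≡⟨ columnOp (f x) (g y) (g v) (G v y) ⟩
    f x ∧ (g y xor (g v ∧ G v y))             ∎
  separationLC : ∀ {S} → Separation G S → Separation H S
  separationLC {S} sep {x} {y} Sx ¬Sy Hxy = noRow (T? (S v))
    where
    -- A new edge across the cut joins two neighbours of `v`, one of which lies on the other side
    -- from `v`.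
    commonNeighbour : T (G v x) × T (G v y)
    commonNeighbour = Equivalence.to T-∧ (subst T
      (trans (lc (separated⇒≢ {S = S} Sx ¬Sy)) (cong (_xor (G v x ∧ G v y)) (¬T⇒≡false (sep Sx ¬Sy)))) Hxy)
    noRow : Dec (T (S v)) → ⊥
    noRow (yes Sv) = sep Sv ¬Sy (proj₂ commonNeighbour)
    noRow (no ¬Sv) = sep Sx ¬Sv (subst T (G-sym v x) (proj₁ commonNeighbour))

localComp-LC : ∀ (G : Graph n) v → LC v G (localComp G v)
localComp-LC G v {x} {y} x≢y with G v x | G v y | x ≟ y
... | _     | _     | yes x≡y = contradiction x≡y x≢y
... | false | _     | no _    = sym (xor-identityʳ (G x y))
... | true  | false | no _    = sym (xor-identityʳ (G x y))
... | true  | true  | no _    = sym (xor-comm (G x y) true)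

localComp-simple : ∀ {G : Graph n} → IsSimple G → ∀ v → IsSimple (localComp G v)
localComp-simple {G = G} (G-sym , G-irr) v = symmetric , irreflexive
  where
  symmetric : ∀ x y → localComp G v x y ≡ localComp G v y x
  symmetric x y = byCases (x ≟ y)
    where
    byCases : Dec (x ≡ y) → localComp G v x y ≡ localComp G v y x
    byCases (yes refl) = refl
    byCases (no x≢y)   = trans (localComp-LC G v x≢y) (trans
      (cong₂ _xor_ (G-sym x y) (∧-comm (G v x) (G v y))) (sym (localComp-LC G v (≢-sym x≢y))))
  irreflexive : ∀ x → localComp G v x x ≡ false
  irreflexive x with G v x | x ≟ x
  ... | false | _ = G-irr x
  ... | true | yes _ = G-irr x
  ... | true | no x≢x = contradiction refl x≢x

LCStep⇒≼ : ∀ {G H : Graph n} → IsSimple G → LCStep G H → IsSimple H × G ≼ H × H ≼ G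
LCStep⇒≼ {G = G} {H} simpG (v , eq) = simpH , LC⇒≼ simpG lc , LC⇒≼ simpH (LC-sym simpG simpH lc)
  where
  lc : LC v G H
  lc x≢y = trans (eq _ _) (localComp-LC G v x≢y)
  simpH : IsSimple H
  simpH = (λ x y → trans (eq x y) (trans (proj₁ (localComp-simple simpG v) x y) (sym (eq y x))))
        , (λ x → trans (eq x x) (proj₂ (localComp-simple simpG v) x))

locallyEquivalent⇒≼ : ∀ {G H : Graph n} → IsSimple G → LocallyEquivalent G H → G ≼ H × H ≼ G
locallyEquivalent⇒≼ simpG ε = ≼-refl , ≼-refl
locallyEquivalent⇒≼ simpG (s ◅ t) with LCStep⇒≼ simpG s
... | simpF , G≼F , F≼G with locallyEquivalent⇒≼ simpF t
...   | F≼H , H≼F = ≼-trans G≼F F≼H , ≼-trans H≼F F≼G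

-- Recovering the adjacency from the cuts

-- Makes a set of reachable vertices Boolean. The double negation is harmless, as the goals are
-- negations or decidable.
finitelyDecidable : ∀ {n} (P : Fin n → Set) → ¬ ¬ (∀ x → Dec (P x))
finitelyDecidable {zero}  P k = k λ ()
finitelyDecidable {suc n} P k =
  ¬¬-excluded-middle λ d → finitelyDecidable (P ∘ suc) λ ds → k λ { zero → d ; (suc x) → ds x }

module _ {G H : Graph n} (admG : Admissible G) (H≼G : H ≼ G)
         (two : ∀ {x} → HasTwoNeighbours H x → HasTwoNeighbours G x) where

  open Admissible admG

  -- The component of `u` in `H` has no leaving edges in `H`, hence none in `G`.
  adjacent⇒connected : ∀ {u v} → T (G u v) → ¬ ¬ Walk H (λ _ → ⊤) u v
  adjacent⇒connected {u} uv ¬r = finitelyDecidable (Walk H (λ _ → ⊤) u) λ d →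
    separation H≼G {S = λ z → ⌊ d z ⌋} (λ Sx ¬Sy xy → ¬Sy (fromWitness (snoc (toWitness Sx) xy tt)))
      (fromWitness (here tt)) (¬r ∘ toWitness) uv

  module SeparatingVertex {u v w} (uv : T (G u v)) (w≢u : w ≢ u) (w≢v : w ≢ v)
           (route : Walk H (λ _ → ⊤) u v) (¬r : ¬ Walk H (_≢ w) u v)
           (d : ∀ z → Dec (Walk H (_≢ w) u z)) where

    S₁ S₂ : Fin n → Bool
    S₁ z = ⌊ d z ⌋
    S₂ z = ⌊ d z ⊎-dec (z ≟ w) ⌋

    u∈S₁ : T (S₁ u)
    u∈S₁ = fromWitness (here (≢-sym w≢u))

    S₁⊆S₂ : ∀ {z} → T (S₁ z) → T (S₂ z)
    S₁⊆S₂ i = fromWitness (inj₁ (toWitness i))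

    w∉S₁ : ¬ T (S₁ w)
    w∉S₁ i = end (toWitness i) refl

    w∈S₂ : T (S₂ w)
    w∈S₂ = fromWitness (inj₂ refl)

    v∉S₁ : ¬ T (S₁ v)
    v∉S₁ = ¬r ∘ toWitness

    beyond : ∀ {z} → ¬ T (S₁ z) → z ≢ w → ¬ T (S₂ z)
    beyond ∉S₁ z≢w i with toWitness i
    ... | inj₁ r   = ∉S₁ (fromWitness r)
    ... | inj₂ z≡w = z≢w z≡w

    v∉S₂ : ¬ T (S₂ v)
    v∉S₂ = beyond v∉S₁ (≢-sym w≢v)

    leave₁ : ∀ {x y} → T (S₁ x) → ¬ T (S₁ y) → T (H x y) → y ≡ w
    leave₁ {y = y} Sx ¬Sy xy = decidable-stable (y ≟ w) λ y≢w →
      ¬Sy (fromWitness (snoc (toWitness Sx) xy y≢w))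

    leave₂ : ∀ {x y} → T (S₂ x) → ¬ T (S₂ y) → T (H x y) → x ≡ w
    leave₂ Sx ¬Sy xy with toWitness Sx
    ... | inj₂ x≡w = x≡w
    ... | inj₁ r   = contradiction (fromWitness (inj₂ (leave₁ (fromWitness r) (¬Sy ∘ S₁⊆S₂) xy))) ¬Sy

    split₁ : Split H S₁
    split₁ = (λ x → H x w) , (λ y → ⌊ y ≟ w ⌋) , λ Sx ¬Sy → starColumn H (_ ≟ w) (leave₁ Sx ¬Sy)

    split₂ : Split H S₂
    split₂ = (λ x → ⌊ x ≟ w ⌋) , H w , λ Sx ¬Sy → starRow H (_ ≟ w) (leave₂ Sx ¬Sy)

    -- The route enters `w` from `S₁` and leaves `S₂` from `w`; the two edges have distinct other
    -- ends.
    twoH : (∀ {x y} → T (H x y) → T (H y x)) → HasTwoNeighbours H w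
    twoH flip with exit S₁ route u∈S₁ v∉S₁ | exit S₂ route (S₁⊆S₂ u∈S₁) v∉S₂
    ... | a , b , a∈ , b∉ , ab | c , e , c∈ , e∉ , ce with leave₁ a∈ b∉ ab | leave₂ c∈ e∉ ce
    ...   | refl | refl = a , e , flip ab , ce , λ { refl → e∉ (S₁⊆S₂ a∈) }

    -- The edges `uv` and `wr` of `G` both cross the cut of `S₁` if `r` lies in it, and that of `S₂`
    -- otherwise; `exchange` swaps their ends.
    neighbour : ∀ {r} → T (G w r) → (T (G u w) × T (G r v)) ⊎ (T (G w v) × T (G u r))
    neighbour {r} wr with T? (S₁ r)
    ... | yes r∈S₁ = inj₁
      ( exchange (split H≼G split₁) u∈S₁ r∈S₁ v∉S₁ w∉S₁ uv (~sym wr)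
      , exchange (split H≼G split₁) r∈S₁ u∈S₁ w∉S₁ v∉S₁ (~sym wr) uv)
    ... | no r∉S₁ = inj₂
      ( exchange (split H≼G split₂) w∈S₂ (S₁⊆S₂ u∈S₁) r∉S₂ v∉S₂ wr uv
      , exchange (split H≼G split₂) (S₁⊆S₂ u∈S₁) w∈S₂ v∉S₂ r∉S₂ uv wr)
      where r∉S₂ = beyond r∉S₁ (≢-sym (~irrefl wr))

    impossible : ¬ HasTwoNeighbours G w
    impossible nbrs@(p , q , wp , wq , p≢q) with T? (G w u) | T? (G w v)
    -- Every neighbour of `w` must then be adjacent to `u`, and two of them form a four-cycle with
    -- diagonal `wu`.
    ... | no ¬wu | _ = ¬wu (square w≢u p≢q wp (toU wp) wq (toU wq))
      where
      toU : ∀ {r} → T (G w r) → T (G u r)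
      toU wr with neighbour wr
      ... | inj₁ (uw , _) = contradiction (~sym uw) ¬wu
      ... | inj₂ (_ , ur) = ur
    ... | yes _ | no ¬wv = ¬wv (square w≢v p≢q wp (toV wp) wq (toV wq))
      where
      toV : ∀ {r} → T (G w r) → T (G v r)
      toV wr with neighbour wr
      ... | inj₁ (_ , rv) = ~sym rv
      ... | inj₂ (wv , _) = contradiction wv ¬wv
    -- A neighbour of `w` is joined to `u` by `neighbour` itself or as diagonal of a four-cycle
    -- through `w` and `v`, so `w` is simplicial.
    ... | yes wu | yes _ = nonSimplicial nbrs (dominated⇒simplicial wu toU)
      where
      toU : ∀ {r} → T (G w r) → r ≢ u → T (G r u)
      toU wr r≢u with neighbour wr
      ... | inj₁ (_ , rv) = square r≢u w≢v (~sym wr) (~sym wu) rv uv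
      ... | inj₂ (_ , ur) = ~sym ur

  -- Otherwise some `w` separates `u` from `v` in `H`. It has two neighbours in `H`, hence in `G`,
  -- against `impossible`.
  adjacent⇒adjacent : Admissible H → ∀ {u v} → T (G u v) → T (H u v)
  adjacent⇒adjacent admH {u} {v} uv = decidable-stable (T? (H u v)) λ ¬uv →
    adjacent⇒connected uv λ route → ¬uv (viaPath route (proj₁ (walk⇒path route)))
    where
    open Admissible admH using () renaming (~sym to ~symH; unseparated⇒adjacent to unseparated)
    viaPath : Walk H (λ _ → ⊤) u v → Path H u v → T (H u v)
    viaPath _ [ _ ] = contradiction refl (~irrefl uv)
    viaPath route (cons _ ux p u∉p) = unseparated ux p u∉p λ w w≢u w≢v ¬r →
      finitelyDecidable (Walk H (_≢ w) u) λ d →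
        let open SeparatingVertex uv w≢u w≢v route ¬r d in impossible (two (twoH ~symH))

-- Matching the vertices of degree at most 1

module LeafMismatch {G H : Graph n} (simpG : IsSimple G) (admH : Admissible H) (G≼H : G ≼ H) (H≼G : H ≼ G)
                    {a} (¬twoG : ¬ HasTwoNeighbours G a) (twoH : HasTwoNeighbours H a) where

  open Admissible admH

  leafNeighbour : ∃[ b ] T (G a b)
  leafNeighbour with any? (λ b → T? (G a b))
  ... | yes found = found
  -- If `a` is isolated in `G`, its singleton is a separation, so `a` is isolated in `H` too.
  ... | no none = let (x , _ , ax , _) = twoH in
    ⊥-elim (separation G≼H {S = λ z → ⌊ z ≟ a ⌋} isolated
      (fromWitness refl) (λ i → ~irrefl ax (sym (toWitness i))) ax)
    where
    isolated : Separation G (λ z → ⌊ z ≟ a ⌋)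
    isolated Sx _ xy with toWitness Sx
    ... | refl = none (_ , xy)

  module _ {b} (ab : T (G a b)) where

    private
      S : Fin n → Bool
      S z = ⌊ (z ≟ a) ⊎-dec (z ≟ b) ⌋
      a∈S : T (S a)
      a∈S = fromWitness (inj₁ refl)
      b∈S : T (S b)
      b∈S = fromWitness (inj₂ refl)
      ∉S : ∀ {z} → z ≢ a → z ≢ b → ¬ T (S z)
      ∉S z≢a z≢b i with toWitness i
      ... | inj₁ z≡a = z≢a z≡a
      ... | inj₂ z≡b = z≢b z≡b
      a≢b : a ≢ b
      a≢b refl = subst T (proj₂ simpG a) ab
      only : ∀ {y} → T (G a y) → y ≡ b
      only {y} ay = decidable-stable (y ≟ b) λ y≢b → ¬twoG (y , b , ay , ab , y≢b)

    -- In `G`, edges leaving the pair `a`, `b` start at `b`, the only neighbour of `a`.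
    leafPair : Split H S
    leafPair = split G≼H ((λ x → ⌊ x ≟ b ⌋) , G b , λ Sx ¬Sy → starRow G (_ ≟ b) (leave Sx ¬Sy))
      where
      leave : ∀ {x y} → T (S x) → ¬ T (S y) → T (G x y) → x ≡ b
      leave Sx ¬Sy xy with toWitness Sx
      ... | inj₂ x≡b  = x≡b
      ... | inj₁ refl = contradiction (fromWitness (inj₂ (only xy))) ¬Sy

    -- With another neighbour in `H`, `b` would by `leafPair` see all outside neighbours of `a`.
    -- Then `a` is simplicial if `ab` is an edge, and otherwise `square` forces that edge.
    hubBecomesLeaf : ∀ {y} → T (H b y) → y ≡ a
    hubBecomesLeaf {y} by = decidable-stable (y ≟ a) twins
      where
      twins : y ≢ a → ⊥
      twins y≢a = byCases (T? (H a b)) twoH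
        where
        toB : ∀ {r} → T (H a r) → r ≢ b → T (H r b)
        toB ar r≢b = ~sym (exchange leafPair b∈S a∈S (∉S y≢a (≢-sym (~irrefl by)))
                             (∉S (≢-sym (~irrefl ar)) r≢b) by ar)
        byCases : Dec (T (H a b)) → HasTwoNeighbours H a → ⊥
        byCases (yes ab) two = nonSimplicial two (dominated⇒simplicial ab toB)
        byCases (no ¬ab) (p , q , ap , aq , p≢q) = ¬ab (square a≢b p≢q ap (~sym (toB ap (≢b ap))) aq (~sym (toB aq (≢b aq))))
          where
          ≢b : ∀ {r} → T (H a r) → r ≢ b
          ≢b ar refl = ¬ab ar

    hubStaysAdjacent : T (H b a)
    hubStaysAdjacent = decidable-stable (T? (H b a)) λ ¬ba →
      separation H≼G {S = λ z → ⌊ z ≟ b ⌋} (isolated ¬ba) (fromWitness refl)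
        (λ i → a≢b (toWitness i)) (subst T (proj₁ simpG a b) ab)
      where
      isolated : ¬ T (H b a) → Separation H (λ z → ⌊ z ≟ b ⌋)
      isolated ¬ba Sx _ xy with toWitness Sx
      ... | refl with hubBecomesLeaf xy
      ...   | refl = ¬ba xy

    -- Otherwise the pair `a`, `b` is a component of `G`, yet in `H` an edge from `a` leaves it.
    hubHasTwoNeighbours : HasTwoNeighbours G b
    hubHasTwoNeighbours = decidable-stable (hasTwoNeighbours? G b) λ ¬twoGb → impossible ¬twoGb twoH
      where
      closed : ¬ HasTwoNeighbours G b → Separation G S
      closed ¬twoGb {y = y} Sx ¬Sy xy with toWitness Sx
      ... | inj₁ refl = ¬Sy (fromWitness (inj₂ (only xy)))
      ... | inj₂ refl = ¬twoGb (y , a , xy , subst T (proj₁ simpG a b) ab , λ { refl → ¬Sy a∈S })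
      impossible : ¬ HasTwoNeighbours G b → ¬ HasTwoNeighbours H a
      impossible ¬twoGb (p , q , ap , aq , p≢q) with p ≟ b | q ≟ b
      ... | yes refl | yes refl = p≢q refl
      ... | no p≢b   | _        = separation G≼H (closed ¬twoGb) a∈S (∉S (≢-sym (~irrefl ap)) p≢b) ap
      ... | yes _    | no q≢b   = separation G≼H (closed ¬twoGb) a∈S (∉S (≢-sym (~irrefl aq)) q≢b) aq

-- Exchanging a leaf with its neighbour

transpose-fst : ∀ (a b : Fin n) → transpose a b ⟨$⟩ʳ a ≡ b
transpose-fst a b rewrite dec-true (a ≟ a) refl = refl

transpose-snd : ∀ {a b : Fin n} → a ≢ b → transpose a b ⟨$⟩ʳ b ≡ a
transpose-snd {a = a} {b} a≢b rewrite dec-false (b ≟ a) (≢-sym a≢b) | dec-true (b ≟ b) refl = refl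

transpose-other : ∀ {a b x : Fin n} → x ≢ a → x ≢ b → transpose a b ⟨$⟩ʳ x ≡ x
transpose-other {a = a} {b} {x} x≢a x≢b rewrite dec-false (x ≟ a) x≢a | dec-false (x ≟ b) x≢b = refl

-- Exchanging a leaf b with its only neighbour a is the pivot on ab, that is,
-- the local complementation at a followed by the one at b.
module _ {H : Graph n} (simpH : IsSimple H) {a b} (ba : T (H b a)) (leaf : ∀ {y} → T (H b y) → y ≡ a) where

  private
    H-sym = proj₁ simpH
    H-irr = proj₂ simpH
    a≢b : a ≢ b
    a≢b refl = subst T (H-irr a) ba
    F H′ : Graph n
    F  = localComp H a
    H′ = relabel H (transpose a b)
    simpF : IsSimple F
    simpF = localComp-simple simpH a
    simpH′ : IsSimple H′
    simpH′ = (λ _ _ → H-sym _ _) , λ _ → H-irr _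
    Hba : H b a ≡ true
    Hba = Equivalence.to T-≡ ba
    Hab : H a b ≡ true
    Hab = trans (H-sym a b) Hba
    Hb : ∀ {y} → y ≢ a → H b y ≡ false
    Hb y≢a = ¬T⇒≡false (y≢a ∘ leaf)
    Fa : ∀ y → F a y ≡ H a y
    Fa = LC-row simpH simpF (localComp-LC H a)
    Fba : F b a ≡ true
    Fba = trans (proj₁ simpF b a) (trans (Fa b) Hab)
    -- Complementing at `a` joins the leaf `b` to all other neighbours of `a`.
    Fb : ∀ {y} → y ≢ a → y ≢ b → F b y ≡ H a y
    Fb {y} y≢a y≢b = trans (localComp-LC H a (≢-sym y≢b))
      (cong₂ (λ s t → s xor (t ∧ H a y)) (Hb y≢a) Hab)

    Pivot : Fin n → Fin n → Set
    Pivot x y = H′ x y ≡ F x y xor (F b x ∧ F b y)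

    pivot-sym : ∀ {x y} → Pivot x y → Pivot y x
    pivot-sym {x} {y} eq = trans (H-sym _ _) (trans eq
      (cong₂ _xor_ (proj₁ simpF x y) (∧-comm (F b x) (F b y))))

    open ≡-Reasoning

    -- In `F` the adjacent vertices `a` and `b` have the same other neighbours, so complementing at
    -- `b` leaves `a` only the edge to `b`.
    pivot-hub : ∀ {y} → a ≢ y → Pivot a y
    pivot-hub {y} a≢y with y ≟ b
    ... | yes refl = begin
      H′ a b                      ≡⟨ cong₂ H (transpose-fst a b) (transpose-snd a≢b) ⟩
      H b a                       ≡⟨ Hba ⟩
      true                        ≡⟨ cong₂ (λ s t → s xor (true ∧ t)) (trans (Fa b) Hab) (proj₂ simpF b) ⟨
      F a b xor (true ∧ F b b)    ≡⟨ cong (λ s → F a b xor (s ∧ F b b)) Fba ⟨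
      F a b xor (F b a ∧ F b b)   ∎
    ... | no y≢b = begin
      H′ a y                      ≡⟨ cong₂ H (transpose-fst a b) (transpose-other (≢-sym a≢y) y≢b) ⟩
      H b y                       ≡⟨ Hb (≢-sym a≢y) ⟩
      false                       ≡⟨ xor-same (H a y) ⟨
      H a y xor H a y             ≡⟨ cong₂ _xor_ (Fa y) (cong₂ _∧_ Fba (Fb (≢-sym a≢y) y≢b)) ⟨
      F a y xor (F b a ∧ F b y)   ∎

    pivot-leaf : ∀ {y} → y ≢ a → y ≢ b → Pivot b y
    pivot-leaf {y} y≢a y≢b = begin
      H′ b y                      ≡⟨ cong₂ H (transpose-snd a≢b) (transpose-other y≢a y≢b) ⟩
      H a y                       ≡⟨ Fb y≢a y≢b ⟨
      F b y                       ≡⟨ xor-identityʳ (F b y) ⟨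
      F b y xor false             ≡⟨ cong (λ s → F b y xor (s ∧ F b y)) (proj₂ simpF b) ⟨
      F b y xor (F b b ∧ F b y)   ∎

    -- Here `b` in `F` has the neighbours of `a` in `H`, so the two complementations cancel.
    pivot-other : ∀ {x y} → x ≢ a → x ≢ b → y ≢ a → y ≢ b → x ≢ y → Pivot x y
    pivot-other {x} {y} x≢a x≢b y≢a y≢b x≢y = begin
      H′ x y                                          ≡⟨ cong₂ H (transpose-other x≢a x≢b) (transpose-other y≢a y≢b) ⟩
      H x y                                           ≡⟨ xor-cancel (H x y) (H a x ∧ H a y) ⟨
      (H x y xor (H a x ∧ H a y)) xor (H a x ∧ H a y) ≡⟨ cong₂ _xor_ (localComp-LC H a x≢y)
                                                           (cong₂ _∧_ (Fb x≢a x≢b) (Fb y≢a y≢b)) ⟨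
      F x y xor (F b x ∧ F b y)                       ∎

    pivot : LC b F H′
    pivot {x} {y} x≢y = byCases (x ≟ a) (y ≟ a) (x ≟ b) (y ≟ b)
      where
      byCases : Dec (x ≡ a) → Dec (y ≡ a) → Dec (x ≡ b) → Dec (y ≡ b) → Pivot x y
      byCases (yes refl) _          _          _          = pivot-hub x≢y
      byCases (no _)     (yes refl) _          _          = pivot-sym {a} {x} (pivot-hub (≢-sym x≢y))
      byCases (no _)     (no y≢a)   (yes refl) _          = pivot-leaf y≢a (≢-sym x≢y)
      byCases (no x≢a)   (no _)     (no x≢b)   (yes refl) = pivot-sym {b} {x} (pivot-leaf x≢a x≢b)
      byCases (no x≢a)   (no y≢a)   (no x≢b)   (no y≢b)   = pivot-other x≢a x≢b y≢a y≢b x≢y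

  leafSwap : H ≼ relabel H (transpose a b) × relabel H (transpose a b) ≼ H
  leafSwap = ≼-trans (LC⇒≼ simpH toF) (LC⇒≼ {v = b} simpF pivot)
           , ≼-trans (LC⇒≼ {v = b} simpH′ (LC-sym {v = b} simpF simpH′ pivot)) (LC⇒≼ simpF (LC-sym simpH simpF toF))
    where
    toF : LC a H F
    toF = localComp-LC H a

relabel-hasTwoNeighbours : ∀ (G : Graph n) π {v} → HasTwoNeighbours (relabel G π) v → HasTwoNeighbours G (π ⟨$⟩ʳ v)
relabel-hasTwoNeighbours G π (x , y , vx , vy , x≢y) = _ , _ , vx , vy , x≢y ∘ permutation-injective π

matchLeaves : ∀ {G H : Graph n} → IsSimple G → Admissible H → G ≼ H → H ≼ G → (xs : List (Fin n)) →
              Σ (Permutation′ n) λ π → G ≼ relabel H π × relabel H π ≼ G ×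
                (∀ {x} → x ∈ xs → HasTwoNeighbours (relabel H π) x → HasTwoNeighbours G x)
matchLeaves simpG admH G≼H H≼G [] = idₚ , G≼H , H≼G , λ ()
matchLeaves {G = G} {H} simpG admH G≼H H≼G (a ∷ xs) with matchLeaves simpG admH G≼H H≼G xs
... | π , G≼Hπ , Hπ≼G , good with hasTwoNeighbours? G a | hasTwoNeighbours? (relabel H π) a
...   | yes twoG | _        = π , G≼Hπ , Hπ≼G , λ { (here refl) _ → twoG ; (there i) → good i }
...   | no _     | no ¬twoH = π , G≼Hπ , Hπ≼G , λ { (here refl) t → contradiction t ¬twoH ; (there i) → good i }
-- After the swap `a` carries the leaf; `b` has two neighbours in `G`, so no mismatch arises there;
-- other vertices keep their degrees.
...   | no ¬twoG | yes twoH = transpose a b ∘ₚ π , ≼-trans G≼Hπ (proj₁ swapped) , ≼-trans (proj₂ swapped) Hπ≼G , good′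
  where
  Hπ   = relabel H π
  admπ = relabel-admissible admH π
  open LeafMismatch {H = Hπ} simpG admπ G≼Hπ Hπ≼G ¬twoG twoH
  b    = proj₁ leafNeighbour
  ab   = proj₂ leafNeighbour
  leaf : ∀ {y} → T (Hπ b y) → y ≡ a
  leaf = hubBecomesLeaf ab
  swapped = leafSwap {H = Hπ} (Admissible.simple admπ) (hubStaysAdjacent ab) leaf
  leafAgain : ∀ {A : Set} → HasTwoNeighbours Hπ b → A
  leafAgain (p , q , bp , bq , p≢q) = contradiction (trans (leaf bp) (sym (leaf bq))) p≢q
  good′ : ∀ {x} → x ∈ a ∷ xs → HasTwoNeighbours (relabel Hπ (transpose a b)) x → HasTwoNeighbours G x
  good′ {x} i two = byCases (x ≟ a) (x ≟ b) i
    where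
    two′ : HasTwoNeighbours Hπ (transpose a b ⟨$⟩ʳ x)
    two′ = relabel-hasTwoNeighbours Hπ (transpose a b) {x} two
    byCases : Dec (x ≡ a) → Dec (x ≡ b) → x ∈ a ∷ xs → HasTwoNeighbours G x
    byCases _          (yes refl) _ = hubHasTwoNeighbours ab
    byCases (yes refl) (no _)     _ = leafAgain (subst (HasTwoNeighbours Hπ) (transpose-fst a b) two′)
    byCases (no x≢a)   (no _)     (here x≡a) = contradiction x≡a x≢a
    byCases (no x≢a)   (no x≢b)   (there j)  = good j (subst (HasTwoNeighbours Hπ) (transpose-other x≢a x≢b) two′)

theorem1p4 : ∀ (n : ℕ) (G H : Graph n) →
    IsSimple G → IsSimple H →
    IsBlockGraph G → IsBlockGraph H →
    NoSimplicialDeg≥2 G → NoSimplicialDeg≥2 H →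
    LocallyEquivalent G H →
    Isomorphic G H
theorem1p4 n G H simpG simpH blockG blockH noSimpG noSimpH G~H
  with locallyEquivalent⇒≼ simpG G~H
... | G≼H , H≼G with matchLeaves simpG (admissible simpH blockH noSimpH) G≼H H≼G (allFin n)
...   | π , G≼Hπ , Hπ≼G , good = π , λ x y → T-injective (toH {x} {y}) toG
  where
  admG = admissible simpG blockG noSimpG
  Hπ   = relabel H π
  admπ = relabel-admissible (admissible simpH blockH noSimpH) π
  simpπ = Admissible.simple admπ
  fewer : ∀ {x} → HasTwoNeighbours Hπ x → HasTwoNeighbours G x
  fewer = good (∈-allFin _)
  more : ∀ {x} → HasTwoNeighbours G x → HasTwoNeighbours Hπ x
  -- With the roles of the graphs exchanged, a mismatch at `x` yields a vertex with two neighbours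
  -- in `Hπ` that is a leaf in `G`, against `fewer`.
  more {x} two = decidable-stable (hasTwoNeighbours? Hπ x) λ ¬two →
    let open LeafMismatch {G = Hπ} simpπ admG Hπ≼G G≼Hπ ¬two two
        (b , xb) = leafNeighbour
        (p , q , bp , bq , p≢q) = fewer (hubHasTwoNeighbours xb)
    in p≢q (trans (hubBecomesLeaf xb bp) (sym (hubBecomesLeaf xb bq)))
  toH : ∀ {x y} → T (G x y) → T (Hπ x y)
  toH = adjacent⇒adjacent {G = G} {H = Hπ} admG Hπ≼G fewer admπ
  toG : ∀ {x y} → T (Hπ x y) → T (G x y)
  toG = adjacent⇒adjacent {G = Hπ} {H = G} admπ G≼Hπ more admG
  T-injective : ∀ {p q} → (T p → T q) → (T q → T p) → p ≡ q
  T-injective {false} {false} _ _ = refl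
  T-injective {false} {true}  _ g = ⊥-elim (g tt)
  T-injective {true}  {false} f _ = ⊥-elim (f tt)
  T-injective {true}  {true}  _ _ = refl
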